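{- There is an absolute constant $C$ such that for all integers $m$ and all integers $n>\sqrt{|m|}$ (with $n\ge3$, so that the expression is defined), $$N_{\mathrm{root}}(4m;-n)\le C\, n(\log n)(\log\log n)^2 .$$ That is, $N_{\mathrm{root}}(4m;-n)=O(n\log n(\log\log n)^2)$ uniformly for $n>\sqrt{|m|}$, with implied constant independent of $m$.
   Context: $Q_{\mathcal D}(a,b,c,d)=2(a^2+b^2+c^2+d^2)-(a+b+c+d)^2$. For a quadruple $\mathbf v$, $|\mathbf v|$ is the sum of absolute values of its coordinates. $\mathbf S_i$ ($i=1,\dots,4$) is the integer matrix replacing the $i$-th coordinate $a_i$ of a quadruple by $2\sum_{j\ne i}a_j-a_i$, other coordinates fixed. An integer quadruple is reduced if no $\mathbf S_i$ strictly decreases $|\cdot|$; a reduced quadruple ordered as $a\le b\le c\le d$ with $a+b+c+d\ge0$ is a root quadruple if $a+b+c\ge d>0$. $N_{\mathrm{root}}(4m;-n)$ is the number of ordered integer root quadruples $(a,b,c,d)$, $a\le b\le c\le d$, with $a+b+c+d>0$, $Q_{\mathcal D}(a,b,c,d)=4m$ and $a=-n$. -}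

module Defs where

import Algebra.Definitions.RawSemiring
open import Data.Fin.Base using (Fin)
open import Data.Integer.Base as ℤ using (ℤ; +_; 0ℤ)
open import Data.List.Base using (length)
open import Data.List.Membership.Propositional using (_∈_)
open import Data.List.Relation.Unary.Unique.Propositional using (Unique)
open import Data.Nat.Base as ℕ using (ℕ; suc)
open import Data.Product.Base using (∃-syntax; _×_)
open import Data.Rational.Base as ℚ using (ℚ; 0ℚ; 1ℚ)
open import Data.Vec.Base as Vec using (Vec; []; _∷_; lookup; removeAt; _[_]≔_)
open import Function.Bundles using (_⇔_)
open import Level using (0ℓ)
open import Relation.Binary.PropositionalEquality.Core using (_≡_)
open import Relation.Nullary.Negation.Core using (¬_)
open import Relation.Unary using (Pred)

open Algebra.Definitions.RawSemiring ℚ.+-*-rawSemiring using (_^_)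

Quadruple : Set
Quadruple = Vec ℤ 4

sumℤ : ∀ {k} → Vec ℤ k → ℤ
sumℤ = Vec.foldr′ ℤ._+_ 0ℤ

Q𝒟 : Quadruple → ℤ
Q𝒟 v = (+ 2) ℤ.* sumℤ (Vec.map (λ x → x ℤ.* x) v) ℤ.- sumℤ v ℤ.* sumℤ v

∥_∥ : Quadruple → ℕ
∥ v ∥ = Vec.sum (Vec.map ℤ.∣_∣ v)

S : Fin 4 → Quadruple → Quadruple
S i v = v [ i ]≔ ((+ 2) ℤ.* sumℤ (removeAt v i) ℤ.- lookup v i)

Reduced : Quadruple → Set
Reduced v = ∀ i → ¬ (∥ S i v ∥ ℕ.< ∥ v ∥)

record IsRoot (a b c d : ℤ) : Set where
  field
    reduced : Reduced (a ∷ b ∷ c ∷ d ∷ [])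
    a≤b     : a ℤ.≤ b
    b≤c     : b ℤ.≤ c
    c≤d     : c ℤ.≤ d
    sum≥0   : 0ℤ ℤ.≤ a ℤ.+ b ℤ.+ c ℤ.+ d
    d≤a+b+c : d ℤ.≤ a ℤ.+ b ℤ.+ c
    d>0     : 0ℤ ℤ.< d

-- The quadruples counted by N_root(k; a₀).
RootWith : (k a₀ : ℤ) → Pred Quadruple 0ℓ
RootWith k a₀ v@(a ∷ b ∷ c ∷ d ∷ []) =
  IsRoot a b c d × 0ℤ ℤ.< a ℤ.+ b ℤ.+ c ℤ.+ d × Q𝒟 v ≡ k × a ≡ a₀

HasCardinality : ∀ {A : Set} → Pred A 0ℓ → ℕ → Set
HasCardinality {A} P N =
  ∃[ xs ] Unique {A = A} xs × (∀ x → x ∈ xs ⇔ P x) × length xs ≡ N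

-- N = N_root(k; a₀)
IsN-root : (k a₀ : ℤ) → ℕ → Set
IsN-root k a₀ N = HasCardinality (RootWith k a₀) N

-- A real number x is represented by its open upper cut { q ∈ ℚ ∣ x < q }.
Realᵘ : Set₁
Realᵘ = Pred ℚ 0ℓ

infix  4 _≤ᵘ_ _<exp_
infixl 7 _*ᵘ_

_≤ᵘ_ : Realᵘ → Realᵘ → Set
X ≤ᵘ Y = ∀ q → Y q → X q

fromℕ : ℕ → Realᵘ
fromℕ n q = (+ n) ℚ./ 1 ℚ.< q

-- The product of non-negative reals; the formula is not valid for negative
-- factors.
_*ᵘ_ : Realᵘ → Realᵘ → Realᵘ
(X *ᵘ Y) q = ∃[ x ] ∃[ y ] X x × Y y × x ℚ.* y ℚ.≤ q

-- x < exp q, for rational x and q.  Here exp q = lim (1 + q/k)ᵏ, which is the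
-- supremum of the terms with 1 + q/k > 0, as those are non-decreasing in k.
_<exp_ : ℚ → ℚ → Set
x <exp q = ∃[ k ] 0ℚ ℚ.< base k × x ℚ.< base k ^ suc k
  where
  base : ℕ → ℚ
  base k = 1ℚ ℚ.+ q ℚ.* ((+ 1) ℚ./ suc k)

-- The natural logarithm of a positive real: log X < q iff X < exp q, iff some
-- rational x satisfies X < x < exp q.
log : Realᵘ → Realᵘ
log X q = ∃[ x ] X x × x <exp q

{-# OPTIONS --safe #-}

-- With X = b - n, Y = c - n and 2k = a + b + c - d, a root quadruple with a = -n
-- becomes a reduced form: 0 ≤ 2k ≤ X ≤ Y and XY - k² = D, where D = n² - m.
-- Reduction gives X < 2n, and Y is determined by X and k, so it remains to count
-- the pairs (X , k) with k < X and X ∣ k² + D.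
--
-- Let k₀ be the least solution modulo X, k = k₀ + j, u = gcd(j, X), v = X / u.
-- Then v ∣ j + 2k₀, so for given X, u, v the number j is determined modulo
-- lcm(u, v) = X / gcd(u, v).  If H² is the largest square dividing D and
-- γ = gcd(v, H), then γ ∣ u and gcd(u, v) ∣ 2γ.  Hence (X , k) can be recovered
-- from v and w = 2γ(u/γ - 1) + ⌊j / lcm(u, v)⌋ < 2u.  Since (w + 1)v ≤ 2X < 4n, the
-- number of such pairs (v , w) is at most Σ_{v<2n} 4n/v = O(n log n).
--
-- For n ≥ 3 one has log n > 36/35 and thus log log n > 1/36, so the remaining
-- factor (log log n)² is absorbed in the constant.
module Submission where

open import Defs

module QuadraticCongruence where

  open import Data.List.Base using (List; []; _∷_; _++_; map; upTo; length)
  open import Data.List.Membership.Propositional using (_∈_)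
  open import Data.List.Membership.Propositional.Properties using (∈-∃++; ∈-++⁺ˡ; ∈-++⁺ʳ; ∈-++⁻; ∈-map⁺; ∈-upTo⁺)
  open import Data.List.Properties using (length-++; length-map; length-upTo)
  open import Data.List.Relation.Unary.All using (_∷_; lookup)
  open import Data.List.Relation.Unary.AllPairs using (_∷_)
  open import Data.List.Relation.Unary.Any using (here; there)
  open import Data.List.Relation.Unary.Unique.Propositional using (Unique)
  open import Data.Nat.Base
  open import Data.Nat.Coprimality as Coprimality using (Coprime; coprime-divisor)
  open import Data.Nat.Divisibility
  open import Data.Nat.DivMod
  open import Data.Nat.GCD
  open import Data.Nat.Induction using (<-rec)
  open import Data.Nat.LCM
  open import Data.Nat.Primality using (Prime; euclidsLemma; irreducible[2]; ¬prime[1])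
  open import Data.Nat.Primality.Factorisation using (factorise)
  open import Data.Nat.Properties
  open import Data.Nat.Tactic.RingSolver using (solve-∀)
  open import Data.Product.Base using (∃; ∃-syntax; _×_; _,_; _,′_; proj₁; proj₂)
  open import Data.Sum.Base using (inj₁; inj₂; reduce; [_,_]′)
  open import Function.Base using (_∘_)
  open import Level using (0ℓ)
  open import Relation.Binary.PropositionalEquality
  open import Relation.Nullary using (yes; no; contradiction)
  open import Relation.Unary using (Pred; Decidable)

  -- Coprimality, and the largest square dividing a number.

  prime-divisor : ∀ n .{{_ : NonZero n}} → n ≢ 1 → ∃[ p ] Prime p × p ∣ n
  prime-divisor n n≢1 with factorise n
  ... | record { factors = []    ; isFactorisation = n≡1 } = contradiction n≡1 n≢1
  ... | record { factors = p ∷ ps ; isFactorisation = n≡ ; factorsPrime = pr ∷ _ } =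
    p , pr , subst (p ∣_) (sym n≡) (m∣m*n _)

  coprime-gcd-quotients : ∀ m n .{{_ : NonZero (gcd m n)}} →
    ∃[ m′ ] ∃[ n′ ] m ≡ m′ * gcd m n × n ≡ n′ * gcd m n × Coprime m′ n′
  coprime-gcd-quotients m n =
    m / gcd m n , n / gcd m n ,
    sym (m/n*n≡m (gcd[m,n]∣m m n)) , sym (m/n*n≡m (gcd[m,n]∣n m n)) ,
    Coprimality.coprime-/gcd m n

  coprime-*ʳ : ∀ {k m n} → Coprime k m → Coprime k n → Coprime k (m * n)
  coprime-*ʳ k⊥m k⊥n (d∣k , d∣mn) =
    k⊥n (d∣k , coprime-divisor (λ (e∣d , e∣m) → k⊥m (∣-trans e∣d d∣k , e∣m)) d∣mn)

  coprime-squares : ∀ {m n} → Coprime m n → Coprime (m * m) (n * n)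
  coprime-squares m⊥n = Coprimality.sym (coprime-*ʳ n²⊥m n²⊥m)
    where n²⊥m = Coprimality.sym (coprime-*ʳ m⊥n m⊥n)

  gcd-nonZeroˡ : ∀ m n .{{_ : NonZero m}} → NonZero (gcd m n)
  gcd-nonZeroˡ m n = ≢-nonZero (gcd[m,n]≢0 m n (inj₁ (≢-nonZero⁻¹ m)))

  gcd-nonZeroʳ : ∀ m n .{{_ : NonZero n}} → NonZero (gcd m n)
  gcd-nonZeroʳ m n = ≢-nonZero (gcd[m,n]≢0 m n (inj₂ (≢-nonZero⁻¹ n)))

  -- Dividing both numbers by their gcd leaves coprime `m′` and `n′` with `m′` dividing `n′ * n′`,
  -- which forces `m′` to be 1.
  square-∣⇒∣ : ∀ m n .{{_ : NonZero m}} → m * m ∣ n * n → m ∣ n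
  square-∣⇒∣ m n m²∣n² with gcd m n | gcd-nonZeroˡ m n | coprime-gcd-quotients m n {{gcd-nonZeroˡ m n}}
  ... | g | g≢0 | m′ , n′ , refl , refl , m′⊥n′ = *-monoˡ-∣ g (∣-trans m′∣1 (1∣ n′))
    where
    instance
      _ = g≢0
      _ = m*n≢0 g g
    swap : ∀ a b → a * b * (a * b) ≡ a * a * (b * b)
    swap = solve-∀
    m′²∣n′² : m′ * m′ ∣ n′ * n′
    m′²∣n′² = *-cancelʳ-∣ (g * g) (subst₂ _∣_ (swap m′ g) (swap n′ g) m²∣n²)
    m′∣1 : m′ ∣ 1
    m′∣1 = ∣-reflexive (m′⊥n′ (∣-refl , coprime-divisor m′⊥n′ (∣-trans (m∣m*n m′) m′²∣n′²)))

  -- A single factor `p` in the hypothesis suffices: once `g * g` is cancelled, the prime `p`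
  -- divides the square of `κ = k / g`, hence `κ` itself.
  prime-square-∣⇒∣ : ∀ {p} g k .{{_ : NonZero g}} → Prime p → g * g * p ∣ k * k → g * p ∣ k
  prime-square-∣⇒∣ {p} g k pr g²p∣k² with square-∣⇒∣ g k (m*n∣⇒m∣ (g * g) p g²p∣k²)
  ... | divides κ refl = subst (_∣ κ * g) (*-comm p g) (*-monoˡ-∣ g p∣κ)
    where
    instance _ = m*n≢0 g g
    swap : ∀ a b → a * b * (a * b) ≡ b * b * (a * a)
    swap = solve-∀
    p∣κ : p ∣ κ
    p∣κ = reduce (euclidsLemma κ κ pr
      (*-cancelˡ-∣ (g * g) (subst (g * g * p ∣_) (swap κ g) g²p∣k²)))

  -- The witness is the lcm `a′ * b′ * g`. After `g * g` is cancelled, the square of `a′` divides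
  -- `q` times the square of `b′`; these squares are coprime, so it divides `q`.
  square-divisors-join : ∀ {D} a b .{{_ : NonZero a}} → a * a ∣ D → b * b ∣ D →
    ∃[ c ] c * c ∣ D × a ∣ c × b ∣ c
  square-divisors-join {D} a b a²∣D b²∣D
    with gcd a b | gcd-nonZeroˡ a b | coprime-gcd-quotients a b {{gcd-nonZeroˡ a b}}
  square-divisors-join {D} _ _ a²∣D (divides q refl)
    | g | g≢0 | a′ , b′ , refl , refl , a′⊥b′ =
    a′ * b′ * g , c²∣D , divides b′ (rot a′ b′ g) , divides a′ (*-assoc a′ b′ g)
    where
    instance
      _ = g≢0
      _ = m*n≢0 g g
    rot : ∀ a b g → a * b * g ≡ b * (a * g)
    rot = solve-∀
    e₁ : ∀ a g → a * g * (a * g) ≡ a * a * (g * g)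
    e₁ = solve-∀
    e₂ : ∀ q b g → q * (b * g * (b * g)) ≡ b * b * q * (g * g)
    e₂ = solve-∀
    e₃ : ∀ a b g → a * a * (b * g * (b * g)) ≡ a * b * g * (a * b * g)
    e₃ = solve-∀
    a′²∣q : a′ * a′ ∣ q
    a′²∣q = coprime-divisor (coprime-squares a′⊥b′)
      (*-cancelʳ-∣ (g * g) (subst₂ _∣_ (e₁ a′ g) (e₂ q b′ g) a²∣D))
    c²∣D : a′ * b′ * g * (a′ * b′ * g) ∣ q * (b′ * g * (b′ * g))
    c²∣D = subst (_∣ q * (b′ * g * (b′ * g))) (e₃ a′ b′ g) (*-monoˡ-∣ (b′ * g * (b′ * g)) a′²∣q)

  -- Maximality of `H * H` is stated through divisibility rather than size, which is the form in
  -- which it is applied to gcds.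
  IsSquareRootPart : ℕ → ℕ → Set
  IsSquareRootPart D H = H * H ∣ D × (∀ a → a * a ∣ D → a ∣ H)

  -- The numbers `a ≤ b` whose square divides `D` are joined one at a time. Taking `b = D` reaches
  -- all of them, because each divides the nonzero `D`.
  squareRootPart : ∀ D .{{_ : NonZero D}} → ∃ (IsSquareRootPart D)
  squareRootPart D = let H , H²∣D , below = bounded D in
    H , H²∣D , λ a a²∣D → below a (∣⇒≤ (m*n∣⇒m∣ a a a²∣D)) a²∣D
    where
    bounded : ∀ b → ∃[ H ] H * H ∣ D × (∀ a → a ≤ b → a * a ∣ D → a ∣ H)
    bounded zero = 1 , 1∣ D , λ { zero _ 0∣D → contradiction (0∣⇒≡0 0∣D) (≢-nonZero⁻¹ D) }
    bounded (suc b) with bounded b | suc b * suc b ∣? D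
    ... | H , H²∣D , below | no b²∤D = H , H²∣D , λ a a≤1+b a²∣D →
      below a (≤-pred (≤∧≢⇒< a≤1+b λ { refl → b²∤D a²∣D })) a²∣D
    ... | H , H²∣D , below | yes b²∣D
      with c , c²∣D , b∣c , H∣c ← square-divisors-join (suc b) H b²∣D H²∣D =
      c , c²∣D , below′
      where
      below′ : ∀ a → a ≤ suc b → a * a ∣ D → a ∣ c
      below′ a a≤1+b a²∣D with a ≟ suc b
      ... | yes refl = b∣c
      ... | no a≢1+b = ∣-trans (below a (≤-pred (≤∧≢⇒< a≤1+b a≢1+b)) a²∣D) H∣c

  -- If `a = 2b`, then the square of `b` divides `D`; if `a` is odd, its square is coprime to 4.
  square-∣-4* : ∀ {D H} → IsSquareRootPart D H → ∀ a → a * a ∣ 4 * D → a ∣ 2 * H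
  square-∣-4* {D} {H} (_ , max) a a²∣4D with 2 ∣? a
  ... | yes (divides b refl) =
    subst (_∣ 2 * H) (*-comm 2 b) (*-monoʳ-∣ 2 (max b (*-cancelˡ-∣ 4 (subst (_∣ 4 * D) (e b) a²∣4D))))
    where
    e : ∀ b → b * 2 * (b * 2) ≡ 4 * (b * b)
    e = solve-∀
  ... | no 2∤a = ∣n⇒∣m*n 2 (max a (coprime-divisor (coprime-squares a⊥2) a²∣4D))
    where
    a⊥2 : Coprime a 2
    a⊥2 (d∣a , d∣2) with irreducible[2] d∣2
    ... | inj₁ refl = refl
    ... | inj₂ refl = contradiction d∣a 2∤a

  -- Divisibility relations between two solutions of k² ≡ -D (mod X).

  ∣-minus : ∀ {d m n} → d ∣ m + n → d ∣ n → d ∣ m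
  ∣-minus {d} {m} {n} d∣ = ∣m+n∣m⇒∣n (subst (d ∣_) (+-comm m n) d∣)

  module Solutions {D H : ℕ} (isH : IsSquareRootPart D H) {X : ℕ} .{{X≢0 : NonZero X}} (k₀ j : ℕ)
    (sol₀ : X ∣ k₀ * k₀ + D) (sol : X ∣ (k₀ + j) * (k₀ + j) + D) where

    private
      H²∣D = proj₁ isH

      instance
        _ = gcd-nonZeroʳ j X

    u v γ : ℕ
    u = gcd j X
    v = X / u
    γ = gcd v H

    v*u≡X : v * u ≡ X
    v*u≡X = m/n*n≡m (gcd[m,n]∣n j X)

    v≢0 : NonZero v
    v≢0 = ≢-nonZero λ v≡0 → ≢-nonZero⁻¹ X (trans (sym v*u≡X) (cong (_* u) v≡0))

    γ≢0 : NonZero γ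
    γ≢0 = gcd-nonZeroˡ v H {{v≢0}}

    private
      v∣X : v ∣ X
      v∣X = subst (v ∣_) v*u≡X (m∣m*n u)

    -- Subtracting the two congruences gives that `X` divides `j * (j + 2 * k₀)`. Dividing by `u`
    -- leaves the factor `j / u`, which is coprime to `v`.
    v∣j+2k₀ : v ∣ j + 2 * k₀
    v∣j+2k₀ = coprime-divisor (Coprimality.sym (Coprimality.coprime-/gcd j X))
      (*-cancelʳ-∣ u (subst₂ _∣_ (sym v*u≡X) lemma X∣j[j+2k₀]))
      where
      e : ∀ k j D → (k + j) * (k + j) + D ≡ j * (j + 2 * k) + (k * k + D)
      e = solve-∀
      X∣j[j+2k₀] : X ∣ j * (j + 2 * k₀)
      X∣j[j+2k₀] = ∣-minus (subst (X ∣_) (e k₀ j D) sol) sol₀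
      e′ : ∀ a b c → a * b * c ≡ a * c * b
      e′ = solve-∀
      lemma : j * (j + 2 * k₀) ≡ (j / u) * (j + 2 * k₀) * u
      lemma = trans (cong (_* (j + 2 * k₀)) (sym (m/n*n≡m (gcd[m,n]∣m j X)))) (e′ (j / u) u (j + 2 * k₀))

    -- If a prime p divided γ / gcd(u, γ), then p · gcd(u, γ) would divide both
    -- roots k₀ and k₀ + j, hence u.
    γ∣u : γ ∣ u
    γ∣u = ∣-trans (∣-reflexive γ≡g) (gcd[m,n]∣m u γ)
      where
      g = gcd u γ
      instance
        g≢0 : NonZero g
        g≢0 = gcd-nonZeroˡ u γ
      γ∣v = gcd[m,n]∣m v H
      γ∣H = gcd[m,n]∣n v H
      g∣γ = gcd[m,n]∣n u γ
      τ = quotient g∣γ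
      γ≡τg : γ ≡ τ * g
      γ≡τg = m∣n⇒n≡quotient*m g∣γ
      -- As `p` divides `γ / g`, the product `g * g * p` divides `g * γ`. The latter divides
      -- `u * v = X` and also `H * H`, hence `D`, and therefore `k * k`.
      root : ∀ {p} k → Prime p → p ∣ τ → X ∣ k * k + D → g * p ∣ k
      root {p} k pr p∣τ X∣ = prime-square-∣⇒∣ g k pr (∣-trans g²p∣gγ (∣-minus (∣-trans gγ∣X X∣) gγ∣D))
        where
        e : ∀ a b c → a * (b * c) ≡ a * c * b
        e = solve-∀
        g²p∣gγ : g * g * p ∣ g * γ
        g²p∣gγ = subst (g * g * p ∣_) (trans (sym (e g τ g)) (cong (g *_) (sym γ≡τg))) (*-monoʳ-∣ (g * g) p∣τ)
        gγ∣X : g * γ ∣ X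
        gγ∣X = subst (g * γ ∣_) (trans (*-comm u v) v*u≡X) (*-pres-∣ (gcd[m,n]∣m u γ) γ∣v)
        gγ∣D : g * γ ∣ D
        gγ∣D = ∣-trans (*-pres-∣ (∣-trans g∣γ γ∣H) γ∣H) H²∣D
      τ≡1 : τ ≡ 1
      τ≡1 with τ ≟ 1
      ... | yes τ≡1 = τ≡1
      ... | no τ≢1 with p , pr , p∣τ ← prime-divisor τ {{quotient≢0 g∣γ {{γ≢0}}}} τ≢1 =
        contradiction (subst Prime p≡1 pr) ¬prime[1]
        where
        gp∣j : g * p ∣ j
        gp∣j = ∣m+n∣m⇒∣n (root (k₀ + j) pr p∣τ sol) (root k₀ pr p∣τ sol₀)
        gp∣γ : g * p ∣ γ
        gp∣γ = subst (g * p ∣_) (trans (*-comm g τ) (sym γ≡τg)) (*-monoʳ-∣ g p∣τ)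
        gp∣g : g * p ∣ g * 1
        gp∣g = subst (g * p ∣_) (sym (*-identityʳ g))
          (gcd-greatest (gcd-greatest gp∣j (∣-trans gp∣γ (∣-trans γ∣v v∣X))) gp∣γ)
        p≡1 : p ≡ 1
        p≡1 = ∣1⇒≡1 (*-cancelˡ-∣ g gp∣g)
      γ≡g : γ ≡ g
      γ≡g = trans γ≡τg (trans (cong (_* g) τ≡1) (*-identityˡ g))

    -- The gcd `g` divides `j` and `j + 2 * k₀`, hence `2 * k₀`; its square divides `u * v = X`,
    -- hence 4(k₀² + D), and therefore `4 * D`. So `g` divides both `2 * H` and `2 * v`.
    gcd∣2γ : gcd u v ∣ 2 * γ
    gcd∣2γ = subst (g ∣_) (sym (c*gcd[m,n]≡gcd[cm,cn] 2 v H))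
      (gcd-greatest (∣n⇒∣m*n 2 g∣v) (square-∣-4* isH g g²∣4D))
      where
      g = gcd u v
      g∣u = gcd[m,n]∣m u v
      g∣v = gcd[m,n]∣n u v
      g∣2k₀ : g ∣ 2 * k₀
      g∣2k₀ = ∣m+n∣m⇒∣n (∣-trans g∣v v∣j+2k₀) (∣-trans g∣u (gcd[m,n]∣m j X))
      g²∣X : g * g ∣ X
      g²∣X = subst (g * g ∣_) v*u≡X (*-pres-∣ g∣v g∣u)
      e : ∀ k D → 4 * (k * k + D) ≡ 4 * D + 2 * k * (2 * k)
      e = solve-∀
      g²∣4D : g * g ∣ 4 * D
      g²∣4D = ∣-minus (subst (g * g ∣_) (e k₀ D) (∣n⇒∣m*n 4 (∣-trans g²∣X sol₀))) (*-pres-∣ g∣2k₀ g∣2k₀)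

  -- Comparing lengths by injection, and lattice points under a hyperbola.

  -- Pigeonhole: the partner of the head is deleted from `ys`, and injectivity keeps the tail from
  -- needing it. A relation replaces a function so that the existential data of a code can stay
  -- inside it.
  length-≤ : ∀ {A B : Set} (R : A → B → Set) → (∀ {x x′ y} → R x y → R x′ y → x ≡ x′) →
    ∀ {xs} ys → Unique xs → (∀ {x} → x ∈ xs → ∃[ y ] y ∈ ys × R x y) → length xs ≤ length ys
  length-≤ R inj {[]} ys _ total = z≤n
  length-≤ {B = B} R inj {x ∷ xs} ys (x∉xs ∷ unique) total
    with y , y∈ys , Rxy ← total (here refl)
    with ys₁ , ys₂ , refl ← ∈-∃++ y∈ys = begin
    suc (length xs)                ≤⟨ s≤s (length-≤ R inj (ys₁ ++ ys₂) unique total′) ⟩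
    suc (length (ys₁ ++ ys₂))      ≡⟨ cong suc (length-++ ys₁) ⟩
    suc (length ys₁ + length ys₂)  ≡⟨ +-suc _ _ ⟨
    length ys₁ + suc (length ys₂)  ≡⟨ length-++ ys₁ ⟨
    length (ys₁ ++ y ∷ ys₂)        ∎
    where
    open ≤-Reasoning
    total′ : ∀ {x′} → x′ ∈ xs → ∃[ y′ ] y′ ∈ ys₁ ++ ys₂ × R x′ y′
    total′ x′∈xs with y′ , y′∈ , Rx′y′ ← total (there x′∈xs) | ∈-++⁻ ys₁ y′∈
    ... | inj₁ y′∈ys₁         = y′ , ∈-++⁺ˡ y′∈ys₁ , Rx′y′
    ... | inj₂ (there y′∈ys₂) = y′ , ∈-++⁺ʳ ys₁ y′∈ys₂ , Rx′y′
    ... | inj₂ (here refl)    = contradiction (inj Rxy Rx′y′) (lookup x∉xs x′∈xs)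

  -- The pairs with 1 ≤ t ≤ T and (w + 1)t ≤ Z; their number is the sum of the floors of Z/t.
  hyperbolaPairs : (Z T : ℕ) → List (ℕ × ℕ)
  hyperbolaPairs Z zero    = []
  hyperbolaPairs Z (suc t) = map (suc t ,′_) (upTo (Z / suc t)) ++ hyperbolaPairs Z t

  ∈-hyperbolaPairs : ∀ {Z T t w} → 0 < t → t ≤ T → suc w * t ≤ Z → (t , w) ∈ hyperbolaPairs Z T
  ∈-hyperbolaPairs {Z} {zero} t>0 t≤T _ = contradiction t≤T (<⇒≱ t>0)
  ∈-hyperbolaPairs {Z} {suc T} {t} {w} t>0 t≤T wt≤Z with t ≟ suc T
  ... | yes refl = ∈-++⁺ˡ (∈-map⁺ _ (∈-upTo⁺
    (subst (_≤ Z / t) (m*n/n≡m (suc w) t) (/-monoˡ-≤ t wt≤Z))))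
  ... | no t≢1+T = ∈-++⁺ʳ _ (∈-hyperbolaPairs t>0 (≤-pred (≤∧≢⇒< t≤T t≢1+T)) wt≤Z)

  length-hyperbolaPairs-suc : ∀ Z t →
    length (hyperbolaPairs Z (suc t)) ≡ Z / suc t + length (hyperbolaPairs Z t)
  length-hyperbolaPairs-suc Z t = trans (length-++ (map (suc t ,′_) (upTo (Z / suc t))))
    (cong (_+ length (hyperbolaPairs Z t)) (trans (length-map (suc t ,′_) (upTo (Z / suc t))) (length-upTo (Z / suc t))))

  -- Row lengths decrease with `t`, so each of the `i` rows after row `a` is at most as long as the
  -- first of them.
  length-hyperbolaPairs-+ : ∀ Z a i →
    length (hyperbolaPairs Z (i + a)) ≤ i * (Z / suc a) + length (hyperbolaPairs Z a)
  length-hyperbolaPairs-+ Z a zero = ≤-refl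
  length-hyperbolaPairs-+ Z a (suc i) = begin
    length (hyperbolaPairs Z (suc (i + a)))                      ≡⟨ length-hyperbolaPairs-suc Z (i + a) ⟩
    Z / suc (i + a) + length (hyperbolaPairs Z (i + a))
      ≤⟨ +-mono-≤ (/-monoʳ-≤ Z (s≤s (m≤n+m a i))) (length-hyperbolaPairs-+ Z a i) ⟩
    Z / suc a + (i * (Z / suc a) + length (hyperbolaPairs Z a))  ≡⟨ +-assoc (Z / suc a) _ _ ⟨
    suc i * (Z / suc a) + length (hyperbolaPairs Z a)            ∎
    where open ≤-Reasoning

  -- Dyadic blocks: each range 2ᴶ ≤ t < 2ᴶ⁺¹ contributes at most Z.
  length-hyperbolaPairs-dyadic : ∀ Z J a → suc a ≡ 2 ^ J → length (hyperbolaPairs Z a) ≤ J * Z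
  length-hyperbolaPairs-dyadic Z zero    zero refl = z≤n
  length-hyperbolaPairs-dyadic Z (suc J) a′   1+a′≡ = begin
    length (hyperbolaPairs Z a′)                          ≡⟨ cong (length ∘ hyperbolaPairs Z) a′≡ ⟩
    length (hyperbolaPairs Z (suc a + a))                 ≤⟨ length-hyperbolaPairs-+ Z a (suc a) ⟩
    suc a * (Z / suc a) + length (hyperbolaPairs Z a)
      ≤⟨ +-mono-≤ (≤-trans (≤-reflexive (*-comm (suc a) (Z / suc a))) (m/n*n≤m Z (suc a)))
                  (length-hyperbolaPairs-dyadic Z J a 1+a≡) ⟩
    suc J * Z                                             ∎
    where
    open ≤-Reasoning
    a = pred (2 ^ J)
    1+a≡ : suc a ≡ 2 ^ J
    1+a≡ = suc-pred (2 ^ J) {{m^n≢0 2 J}}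
    a′≡ : a′ ≡ suc a + a
    a′≡ = suc-injective (trans 1+a′≡ (trans (cong (2 *_) (sym 1+a≡)) (e a)))
      where
      e : ∀ a → 2 * suc a ≡ suc (suc a + a)
      e = solve-∀

  length-hyperbolaPairs-mono : ∀ Z {T T′} → T ≤ T′ →
    length (hyperbolaPairs Z T) ≤ length (hyperbolaPairs Z T′)
  length-hyperbolaPairs-mono Z = go ∘ ≤⇒≤′
    where
    go : ∀ {T T′} → T ≤′ T′ → length (hyperbolaPairs Z T) ≤ length (hyperbolaPairs Z T′)
    go ≤′-refl            = ≤-refl
    go (≤′-step {n} T≤′n) = ≤-trans (go T≤′n)
      (≤-trans (m≤n+m _ (Z / suc n)) (≤-reflexive (sym (length-hyperbolaPairs-suc Z n))))

  length-hyperbolaPairs : ∀ Z T J → T < 2 ^ J → length (hyperbolaPairs Z T) ≤ J * Z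
  length-hyperbolaPairs Z T J T<2^J = ≤-trans
    (length-hyperbolaPairs-mono Z (<⇒≤pred T<2^J))
    (length-hyperbolaPairs-dyadic Z J (pred (2 ^ J)) (suc-pred (2 ^ J) {{m^n≢0 2 J}}))

  -- Encoding the solutions of the congruence by lattice points.

  leastWitness : ∀ {P : Pred ℕ 0ℓ} → Decidable P → ∀ n → P n →
    ∃[ m ] m ≤ n × P m × (∀ l → P l → m ≤ l)
  leastWitness {P} P? = <-rec _ step
    where
    step : ∀ n → (∀ {i} → i < n → P i → ∃[ m ] m ≤ i × P m × (∀ l → P l → m ≤ l)) →
      P n → ∃[ m ] m ≤ n × P m × (∀ l → P l → m ≤ l)
    step n rec Pn with anyUpTo? P? n
    ... | yes (i , i<n , Pi) = let m , m≤i , Pm , min = rec i<n Pi in m , ≤-trans m≤i (<⇒≤ i<n) , Pm , min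
    ... | no none = n , ≤-refl , Pn , λ l Pl → ≮⇒≥ λ l<n → none (l , l<n , Pl)

  -- (t , w) determines the solution k of k² ≡ -D (mod X): t is the v of Solutions,
  -- and w packs u / γ - 1 together with the quotient of j by lcm(u, v).
  record Code (D H X k t w : ℕ) : Set where
    field
      {k₀ j u r s ρ} : ℕ
      X≡     : X ≡ t * u
      root   : X ∣ k₀ * k₀ + D
      least  : ∀ l → X ∣ l * l + D → k₀ ≤ l
      k≡     : k ≡ k₀ + j
      u≡     : u ≡ suc r * gcd t H
      u∣j    : u ∣ j
      t∣j+2k₀ : t ∣ j + 2 * k₀
      j≡     : j ≡ ρ + s * lcm u t
      ρ<     : ρ < lcm u t
      s<     : s < 2 * gcd t H
      w≡     : w ≡ s + r * (2 * gcd t H)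

  quotient-unique : ∀ {m r s r′ s′} → s < m → s′ < m → s + r * m ≡ s′ + r′ * m → r ≡ r′ × s ≡ s′
  quotient-unique {m@(suc _)} {r} {s} {r′} {s′} s<m s′<m eq = r≡r′ , +-cancelʳ-≡ (r * m) s s′ (trans eq (cong (λ r → s′ + r * m) (sym r≡r′)))
    where
    div : ∀ s r → s < m → (s + r * m) / m ≡ r
    div s r s<m = trans (+-distrib-/-∣ʳ s (n∣m*n r)) (cong₂ _+_ (m<n⇒m/n≡0 s<m) (m*n/n≡m r m))
    r≡r′ : r ≡ r′
    r≡r′ = trans (sym (div s r s<m)) (trans (cong (_/ m) eq) (div s′ r′ s′<m))

  ∣∧<⇒≡0 : ∀ {m n} → m ∣ n → n < m → n ≡ 0
  ∣∧<⇒≡0 {n = zero}  _   _   = refl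
  ∣∧<⇒≡0 {n = suc _} m∣n n<m = contradiction m∣n (>⇒∤ n<m)

  -- The difference of `j` and `j′` is a multiple of `u` and of `t`, hence of their lcm. Since the
  -- quotient `s` is shared, it is also a difference of remainders below that lcm, so it vanishes.
  congruent⇒≡ : ∀ {u t c s j j′ ρ ρ′} → u ∣ j → u ∣ j′ → t ∣ j + c → t ∣ j′ + c →
    j ≡ ρ + s * lcm u t → j′ ≡ ρ′ + s * lcm u t → ρ < lcm u t → ρ′ < lcm u t → j ≡ j′
  congruent⇒≡ {u} {t} {c} {s} {j} {j′} u∣j u∣j′ t∣ t∣′ j≡ j′≡ ρ< ρ′< =
    [ (λ j≤j′ → ordered j≤j′ u∣j u∣j′ t∣ t∣′ j≡ j′≡ ρ′<)
    , (λ j′≤j → sym (ordered j′≤j u∣j′ u∣j t∣′ t∣ j′≡ j≡ ρ<)) ]′ (≤-total j j′)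
    where
    ordered : ∀ {j j′ ρ ρ′} → j ≤ j′ → u ∣ j → u ∣ j′ → t ∣ j + c → t ∣ j′ + c →
      j ≡ ρ + s * lcm u t → j′ ≡ ρ′ + s * lcm u t → ρ′ < lcm u t → j ≡ j′
    ordered {j} {ρ = ρ} {ρ′} j≤j′ u∣j u∣j′ t∣ t∣′ j≡ j′≡ ρ′< with δ , refl ← m≤n⇒∃[o]m+o≡n j≤j′ =
      sym (trans (cong (j +_) (∣∧<⇒≡0 (lcm-least u∣δ t∣δ) δ<)) (+-identityʳ j))
      where
      e₁ : ∀ j δ c → j + δ + c ≡ j + c + δ
      e₁ = solve-∀
      u∣δ : u ∣ δ
      u∣δ = ∣m+n∣m⇒∣n u∣j′ u∣j
      t∣δ : t ∣ δ
      t∣δ = ∣m+n∣m⇒∣n (subst (t ∣_) (e₁ j δ c) t∣′) t∣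
      ρ′≡ : ρ + δ ≡ ρ′
      ρ′≡ = +-cancelʳ-≡ (s * lcm u t) (ρ + δ) ρ′
        (trans (e₁ ρ δ (s * lcm u t)) (trans (cong (_+ δ) (sym j≡)) j′≡))
      δ< : δ < lcm u t
      δ< = ≤-<-trans (≤-trans (m≤n+m δ ρ) (≤-reflexive ρ′≡)) ρ′<

  -- Decoding order: `2 * gcd t H` depends on `t` alone, so `w` yields `r` and `s`; `r` yields `u`,
  -- then `X = t * u`, then `k₀` as the least root, and finally `j` by `congruent⇒≡`.
  code-injective : ∀ {D H X X′ k k′ t w} → Code D H X k t w → Code D H X′ k′ t w → X ≡ X′ × k ≡ k′
  code-injective {H = H} {t = t} c c′ = X≡X′ , trans C.k≡ (trans (cong₂ _+_ k₀≡ j≡j′) (sym C′.k≡))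
    where
    module C = Code c
    module C′ = Code c′
    rs≡ = quotient-unique {r = C.r} {r′ = C′.r} C.s< C′.s< (trans (sym C.w≡) C′.w≡)
    u≡u′ : C.u ≡ C′.u
    u≡u′ = trans C.u≡ (trans (cong (λ r → suc r * gcd t H) (proj₁ rs≡)) (sym C′.u≡))
    X≡X′ = trans C.X≡ (trans (cong (t *_) u≡u′) (sym C′.X≡))
    k₀≡ : C.k₀ ≡ C′.k₀
    k₀≡ = ≤-antisym (C.least _ (subst (_∣ _) (sym X≡X′) C′.root)) (C′.least _ (subst (_∣ _) X≡X′ C.root))
    j≡j′ : C.j ≡ C′.j
    j≡j′ = congruent⇒≡ {s = C.s} C.u∣j (subst (_∣ _) (sym u≡u′) C′.u∣j)
      C.t∣j+2k₀ (subst (λ k → t ∣ C′.j + 2 * k) (sym k₀≡) C′.t∣j+2k₀)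
      C.j≡ (trans C′.j≡ (cong₂ (λ s u → C′.ρ + s * lcm u t) (sym (proj₂ rs≡)) (sym u≡u′)))
      C.ρ< (subst (λ u → C′.ρ < lcm u t) (sym u≡u′) C′.ρ<)

  code-exists : ∀ {D H X k} → IsSquareRootPart D H → X ∣ k * k + D → k < X →
    ∃[ t ] ∃[ w ] Code D H X k t w × 0 < t × t ≤ X × suc w * t ≤ 2 * X
  code-exists {D} {H} {X@(suc _)} {k} isH X∣ k<X
    with k₀ , k₀≤k , root , least ← leastWitness (λ l → X ∣? l * l + D) k X∣
    with j , refl ← m≤n⇒∃[o]m+o≡n k₀≤k =
    v , w , code , >-nonZero⁻¹ v , ∣⇒≤ (subst (v ∣_) v*u≡X (m∣m*n u)) , (begin
      -- Since `s < 2 * γ`, `w + 1` is at most `suc r * (2 * γ) = 2 * u`.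
      suc w * v                        ≤⟨ *-monoˡ-≤ v (+-monoˡ-≤ (r * (2 * γ)) s<2γ) ⟩
      suc r * (2 * γ) * v              ≡⟨ e (suc r) γ v ⟩
      2 * (v * (suc r * γ))            ≡⟨ cong (λ u → 2 * (v * u)) u≡ ⟨
      2 * (v * u)                      ≡⟨ cong (2 *_) v*u≡X ⟩
      2 * X                            ∎)
    where
    open ≤-Reasoning
    open Solutions isH k₀ j root X∣
    e : ∀ a b c → a * (2 * b) * c ≡ 2 * (c * (a * b))
    e = solve-∀
    instance
      _ = v≢0
      _ = γ≢0
      _ = m*n≢0 2 γ
    r = pred (quotient γ∣u)
    u≡ : u ≡ suc r * γ
    u≡ = trans (m∣n⇒n≡quotient*m γ∣u)
      (cong (_* γ) (sym (suc-pred (quotient γ∣u) {{quotient≢0 γ∣u {{gcd-nonZeroʳ j X}}}})))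
    M = lcm u v
    X≡gM : X ≡ gcd u v * M
    X≡gM = trans (sym v*u≡X) (trans (*-comm v u) (sym (gcd*lcm u v)))
    instance
      M≢0 : NonZero M
      M≢0 = ≢-nonZero λ M≡0 → contradiction (trans X≡gM (trans (cong (gcd u v *_) M≡0) (*-zeroʳ (gcd u v)))) λ ()
    s = j / M
    w = s + r * (2 * γ)
    -- This is where `k < X` enters: `j < X = gcd u v * M`, and `gcd u v` is at most `2 * γ`.
    s<2γ : s < 2 * γ
    s<2γ = m<n*o⇒m/o<n (begin-strict
      j                ≤⟨ m≤n+m j k₀ ⟩
      k₀ + j           <⟨ k<X ⟩
      X                ≡⟨ X≡gM ⟩
      gcd u v * M      ≤⟨ *-monoˡ-≤ M (∣⇒≤ gcd∣2γ) ⟩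
      2 * γ * M        ∎)
    code : Code D H X (k₀ + j) v w
    code = record
      { X≡ = sym v*u≡X ; root = root ; least = least ; k≡ = refl ; r = r ; u≡ = u≡
      ; u∣j = gcd[m,n]∣m j X ; t∣j+2k₀ = v∣j+2k₀
      ; j≡ = m≡m%n+[m/n]*n j M ; ρ< = m%n<n j M ; s< = s<2γ ; w≡ = refl }

module LogarithmBounds where

  import Algebra.Definitions.RawSemiring
  import Algebra.Properties.CommutativeSemiring.Exp
  import Algebra.Properties.Semiring.Exp
  open import Algebra.Bundles using (CommutativeRing)
  open import Data.Integer.Base as ℤ using (+_)
  import Data.Integer.Properties as ℤ
  open import Data.Nat.Base as ℕ using (ℕ; zero; suc)
  import Data.Nat.Properties as ℕ
  open import Data.Product.Base using (_,_)
  open import Data.Rational.Base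
  open import Data.Rational.Properties
  open import Data.Rational.Solver using (module +-*-Solver)
  import Data.Rational.Unnormalised.Base as ℚᵘ
  import Data.Rational.Unnormalised.Properties as ℚᵘ
  open import Data.Sum.Base using (inj₁; inj₂)
  open import Relation.Binary.PropositionalEquality
  open import Relation.Nullary.Decidable using (from-yes)

  open Algebra.Definitions.RawSemiring +-*-rawSemiring using (_^_)
  open Algebra.Properties.Semiring.Exp (CommutativeRing.semiring +-*-commutativeRing) using (^-assocʳ)
  open Algebra.Properties.CommutativeSemiring.Exp (CommutativeRing.commutativeSemiring +-*-commutativeRing) using (^-distrib-*)

  -- Natural numbers inside ℚ, and inequalities for powers.

  ι : ℕ → ℚ
  ι n = + n / 1

  toℚᵘ-/ : ∀ i d → toℚᵘ (i / suc d) ℚᵘ.≃ ℚᵘ.mkℚᵘ i d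
  toℚᵘ-/ i d = toℚᵘ-fromℚᵘ (ℚᵘ.mkℚᵘ i d)

  ι-* : ∀ m n → ι (m ℕ.* n) ≡ ι m * ι n
  ι-* m n = toℚᵘ-injective (begin
    toℚᵘ (ι (m ℕ.* n))                      ≈⟨ toℚᵘ-/ _ 0 ⟩
    ℚᵘ.mkℚᵘ (+ (m ℕ.* n)) 0                 ≡⟨ cong (λ i → ℚᵘ.mkℚᵘ i 0) (ℤ.pos-* m n) ⟩
    ℚᵘ.mkℚᵘ (+ m) 0 ℚᵘ.* ℚᵘ.mkℚᵘ (+ n) 0    ≈⟨ ℚᵘ.*-cong (toℚᵘ-/ (+ m) 0) (toℚᵘ-/ (+ n) 0) ⟨
    toℚᵘ (ι m) ℚᵘ.* toℚᵘ (ι n)              ≈⟨ toℚᵘ-homo-* (ι m) (ι n) ⟨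
    toℚᵘ (ι m * ι n)                        ∎)
    where open ℚᵘ.≃-Reasoning

  ι-suc : ∀ n → ι (suc n) ≡ 1ℚ + ι n
  ι-suc n = toℚᵘ-injective (begin
    toℚᵘ (ι (suc n))                        ≈⟨ toℚᵘ-/ _ 0 ⟩
    ℚᵘ.mkℚᵘ (+ suc n) 0                     ≈⟨ ℚᵘ.*≡* (cong (λ i → + suc i ℤ.* + 1) (sym (ℕ.*-identityʳ n))) ⟩
    ℚᵘ.mkℚᵘ (+ suc (n ℕ.* 1)) 0             ≡⟨ cong (λ i → ℚᵘ.mkℚᵘ (+ 1 ℤ.+ i) 0) (ℤ.pos-* n 1) ⟩
    ℚᵘ.1ℚᵘ ℚᵘ.+ ℚᵘ.mkℚᵘ (+ n) 0             ≈⟨ ℚᵘ.+-cong ℚᵘ.≃-refl (toℚᵘ-/ (+ n) 0) ⟨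
    toℚᵘ 1ℚ ℚᵘ.+ toℚᵘ (ι n)                 ≈⟨ toℚᵘ-homo-+ 1ℚ (ι n) ⟨
    toℚᵘ (1ℚ + ι n)                         ∎)
    where open ℚᵘ.≃-Reasoning

  ι-mono-≤ : ∀ {m n} → m ℕ.≤ n → ι m ≤ ι n
  ι-mono-≤ {m} {n} m≤n = toℚᵘ-cancel-≤ (ℚᵘ.≤-respˡ-≃ (ℚᵘ.≃-sym (toℚᵘ-/ (+ m) 0)) (ℚᵘ.≤-respʳ-≃ (ℚᵘ.≃-sym (toℚᵘ-/ (+ n) 0))
    (ℚᵘ.*≤* (ℤ.*-monoʳ-≤-nonNeg (+ 1) (ℤ.+≤+ m≤n)))))

  0≤ι : ∀ n → 0ℚ ≤ ι n
  0≤ι n = ι-mono-≤ {0} {n} ℕ.z≤n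

  ι*1/ : ∀ k → ι (suc k) * (+ 1 / suc k) ≡ 1ℚ
  ι*1/ k = toℚᵘ-injective (begin
    toℚᵘ (ι (suc k) * (+ 1 / suc k))                 ≈⟨ toℚᵘ-homo-* (ι (suc k)) (+ 1 / suc k) ⟩
    toℚᵘ (ι (suc k)) ℚᵘ.* toℚᵘ (+ 1 / suc k)         ≈⟨ ℚᵘ.*-cong (toℚᵘ-/ (+ suc k) 0) (toℚᵘ-/ (+ 1) k) ⟩
    ℚᵘ.mkℚᵘ (+ suc k) 0 ℚᵘ.* ℚᵘ.mkℚᵘ (+ 1) k         ≈⟨ ℚᵘ.*≡* (trans (ℤ.*-identityʳ _) (trans (ℤ.*-identityʳ (+ suc k)) (sym (trans (ℤ.*-identityˡ _) (cong (λ i → + suc i) (ℕ.+-identityʳ k)))))) ⟩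
    ℚᵘ.1ℚᵘ                                           ∎)
    where open ℚᵘ.≃-Reasoning

  *-mono-≤-nonNeg : ∀ {p q r s} → 0ℚ ≤ r → 0ℚ ≤ q → p ≤ q → r ≤ s → p * r ≤ q * s
  *-mono-≤-nonNeg {p} {q} {r} {s} 0≤r 0≤q p≤q r≤s = ≤-trans
    (*-monoʳ-≤-nonNeg r {{nonNegative 0≤r}} p≤q) (*-monoˡ-≤-nonNeg q {{nonNegative 0≤q}} r≤s)

  0≤* : ∀ {p q} → 0ℚ ≤ p → 0ℚ ≤ q → 0ℚ ≤ p * q
  0≤* {p} {q} 0≤p 0≤q = subst (_≤ p * q) (*-zeroˡ q) (*-monoʳ-≤-nonNeg q {{nonNegative 0≤q}} 0≤p)

  0≤^ : ∀ {p} n → 0ℚ ≤ p → 0ℚ ≤ p ^ n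
  0≤^ zero    0≤p = nonNegative⁻¹ 1ℚ
  0≤^ (suc n) 0≤p = 0≤* 0≤p (0≤^ n 0≤p)

  ^-monoˡ-≤ : ∀ {p q} n → 0ℚ ≤ p → p ≤ q → p ^ n ≤ q ^ n
  ^-monoˡ-≤ zero    0≤p p≤q = ≤-refl
  ^-monoˡ-≤ (suc n) 0≤p p≤q = *-mono-≤-nonNeg (0≤^ n 0≤p) (≤-trans 0≤p p≤q) p≤q (^-monoˡ-≤ n 0≤p p≤q)

  1^n≡1 : ∀ n → 1ℚ ^ n ≡ 1ℚ
  1^n≡1 zero    = refl
  1^n≡1 (suc n) = trans (*-identityˡ _) (1^n≡1 n)

  p≤p+q : ∀ p {q} → 0ℚ ≤ q → p ≤ p + q
  p≤p+q p {q} 0≤q = subst (_≤ p + q) (+-identityʳ p) (+-monoʳ-≤ p 0≤q)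

  0≤p² : ∀ p → 0ℚ ≤ p * p
  0≤p² p with ≤-total 0ℚ p
  ... | inj₁ 0≤p = 0≤* 0≤p 0≤p
  ... | inj₂ p≤0 = subst (_≤ p * p) (*-zeroˡ p) (*-monoʳ-≤-nonPos p {{nonPositive p≤0}} p≤0)

  -- The inductive step discards the nonnegative term `ι n * (x * x)`. Negative `x ≥ -1` is allowed,
  -- as `exp-bound` also uses it at `- t`.
  bernoulli : ∀ {x} n → 0ℚ ≤ 1ℚ + x → 1ℚ + ι n * x ≤ (1ℚ + x) ^ n
  bernoulli {x} zero    _     = ≤-reflexive (trans (cong (λ z → 1ℚ + z) (*-zeroˡ x)) (+-identityʳ 1ℚ))
  bernoulli {x} (suc n) 0≤1+x = begin
    1ℚ + ι (suc n) * x                             ≡⟨ cong (λ i → 1ℚ + i * x) (ι-suc n) ⟩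
    1ℚ + (1ℚ + ι n) * x                            ≤⟨ p≤p+q _ (0≤* (0≤ι n) (0≤p² x)) ⟩
    1ℚ + (1ℚ + ι n) * x + ι n * (x * x)            ≡⟨ e (ι n) x ⟩
    (1ℚ + x) * (1ℚ + ι n * x)                      ≤⟨ *-monoˡ-≤-nonNeg (1ℚ + x) {{nonNegative 0≤1+x}} (bernoulli n 0≤1+x) ⟩
    (1ℚ + x) * (1ℚ + x) ^ n                        ∎
    where
    open ≤-Reasoning
    open +-*-Solver
    e : ∀ i x → 1ℚ + (1ℚ + i) * x + i * (x * x) ≡ (1ℚ + x) * (1ℚ + i * x)
    e = solve 2 (λ i x → con 1ℚ :+ (con 1ℚ :+ i) :* x :+ i :* (x :* x) := (con 1ℚ :+ x) :* (con 1ℚ :+ i :* x)) refl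

  p≤q⇒0≤q-p : ∀ {p q} → p ≤ q → 0ℚ ≤ q - p
  p≤q⇒0≤q-p {p} {q} p≤q = subst (_≤ q - p) (+-inverseʳ p) (+-monoˡ-≤ (- p) p≤q)

  -- exp(r j) ≤ (1 - r)⁻ʲ.
  exp-bound : ∀ {x q} r j → 0ℚ ≤ r → r ≤ 1ℚ → q ≤ ι j * r → x <exp q → x * (1ℚ - r) ^ j ≤ 1ℚ
  exp-bound {x} {q} r j 0≤r r≤1 q≤jr (k , base>0 , x<) = begin
    x * (1ℚ - r) ^ j                       ≤⟨ *-monoʳ-≤-nonNeg ((1ℚ - r) ^ j) {{nonNegative (0≤^ j 0≤1-r)}} (<⇒≤ x<) ⟩
    base ^ K * (1ℚ - r) ^ j                ≤⟨ *-monoʳ-≤-nonNeg ((1ℚ - r) ^ j) {{nonNegative (0≤^ j 0≤1-r)}} (^-monoˡ-≤ K (<⇒≤ base>0) base≤) ⟩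
    ((1ℚ + t) ^ j) ^ K * (1ℚ - r) ^ j      ≡⟨ cong (_* (1ℚ - r) ^ j) (trans (^-assocʳ (1ℚ + t) j K) (trans (cong ((1ℚ + t) ^_) (ℕ.*-comm j K)) (sym (^-assocʳ (1ℚ + t) K j)))) ⟩
    ((1ℚ + t) ^ K) ^ j * (1ℚ - r) ^ j      ≡⟨ ^-distrib-* ((1ℚ + t) ^ K) (1ℚ - r) j ⟨
    ((1ℚ + t) ^ K * (1ℚ - r)) ^ j          ≤⟨ ^-monoˡ-≤ j (0≤* (0≤^ K 0≤1+t) 0≤1-r) step ⟩
    1ℚ ^ j                                 ≡⟨ 1^n≡1 j ⟩
    1ℚ                                     ∎
    where
    open ≤-Reasoning
    open +-*-Solver
    K = suc k
    e = + 1 / K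
    base = 1ℚ + q * e
    -- With t = r/K, Bernoulli's inequality gives both `base ≤ (1ℚ + t) ^ j` and
    -- `1ℚ - r ≤ (1ℚ - t) ^ K`; the powers of 1 + t and 1 - t then combine through (1 + t)(1 - t) ≤
    -- 1.
    t = r * e
    0≤e : 0ℚ ≤ e
    0≤e = nonNegative⁻¹ e {{normalize-nonNeg 1 K}}
    0≤t = 0≤* 0≤r 0≤e
    0≤1-r = p≤q⇒0≤q-p r≤1
    0≤1+t : 0ℚ ≤ 1ℚ + t
    0≤1+t = +-mono-≤ (nonNegative⁻¹ 1ℚ) 0≤t
    r≡Kt : r ≡ ι K * t
    r≡Kt = trans (sym (*-identityʳ r)) (trans (cong (r *_) (sym (ι*1/ k)))
      (solve 3 (λ r i e → r :* (i :* e) := i :* (r :* e)) refl r (ι K) e))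
    t≤r : t ≤ r
    t≤r = begin
      t          ≡⟨ *-identityˡ t ⟨
      1ℚ * t     ≤⟨ *-monoʳ-≤-nonNeg t {{nonNegative 0≤t}} (ι-mono-≤ {1} {K} (ℕ.s≤s ℕ.z≤n)) ⟩
      ι K * t    ≡⟨ r≡Kt ⟨
      r          ∎
    0≤1-t : 0ℚ ≤ 1ℚ - t
    0≤1-t = p≤q⇒0≤q-p (≤-trans t≤r r≤1)
    base≤ : base ≤ (1ℚ + t) ^ j
    base≤ = begin
      1ℚ + q * e             ≤⟨ +-monoʳ-≤ 1ℚ (*-monoʳ-≤-nonNeg e {{nonNegative 0≤e}} q≤jr) ⟩
      1ℚ + ι j * r * e       ≡⟨ cong (λ z → 1ℚ + z) (*-assoc (ι j) r e) ⟩
      1ℚ + ι j * t           ≤⟨ bernoulli j 0≤1+t ⟩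
      (1ℚ + t) ^ j           ∎
    1-r≤ : 1ℚ - r ≤ (1ℚ - t) ^ K
    1-r≤ = begin
      1ℚ - r                 ≡⟨ cong (λ z → 1ℚ - z) r≡Kt ⟩
      1ℚ - ι K * t           ≡⟨ cong (λ z → 1ℚ + z) (neg-distribʳ-* (ι K) t) ⟩
      1ℚ + ι K * (- t)       ≤⟨ bernoulli K 0≤1-t ⟩
      (1ℚ - t) ^ K           ∎
    1-t²≤1 : (1ℚ + t) * (1ℚ - t) ≤ 1ℚ
    1-t²≤1 = begin
      (1ℚ + t) * (1ℚ - t)            ≤⟨ p≤p+q _ (0≤p² t) ⟩
      (1ℚ + t) * (1ℚ - t) + t * t    ≡⟨ solve 1 (λ t → (con 1ℚ :+ t) :* (con 1ℚ :- t) :+ t :* t := con 1ℚ) refl t ⟩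
      1ℚ                             ∎
    step : (1ℚ + t) ^ K * (1ℚ - r) ≤ 1ℚ
    step = begin
      (1ℚ + t) ^ K * (1ℚ - r)        ≤⟨ *-monoˡ-≤-nonNeg ((1ℚ + t) ^ K) {{nonNegative (0≤^ K 0≤1+t)}} 1-r≤ ⟩
      (1ℚ + t) ^ K * (1ℚ - t) ^ K    ≡⟨ ^-distrib-* (1ℚ + t) (1ℚ - t) K ⟨
      ((1ℚ + t) * (1ℚ - t)) ^ K      ≤⟨ ^-monoˡ-≤ K (0≤* 0≤1+t 0≤1-t) 1-t²≤1 ⟩
      1ℚ ^ K                         ≡⟨ 1^n≡1 K ⟩
      1ℚ                             ∎

  -- Rational lower bounds for real numbers and logarithms.

  infix 4 _≺_
  -- For the open upper cut of a real x this means a ≤ x, in spite of the strict inequality.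
  _≺_ : ℚ → Realᵘ → Set
  a ≺ X = ∀ q → X q → a < q

  *ᵘ-≺ : ∀ {a b X Y} → 0ℚ ≤ a → 0ℚ ≤ b → a ≺ X → b ≺ Y → a * b ≺ X *ᵘ Y
  *ᵘ-≺ {a} {b} 0≤a 0≤b a≺X b≺Y q (x , y , Xx , Yy , xy≤q) = begin-strict
    a * b  ≤⟨ *-monoˡ-≤-nonNeg a {{nonNegative 0≤a}} (<⇒≤ (b≺Y y Yy)) ⟩
    a * y  <⟨ *-monoˡ-<-pos y {{positive (≤-<-trans 0≤b (b≺Y y Yy))}} (a≺X x Xx) ⟩
    x * y  ≤⟨ xy≤q ⟩
    q      ∎
    where open ≤-Reasoning

  ^-pos : ∀ p .{{_ : Positive p}} n → Positive (p ^ n)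
  ^-pos p zero    = _
  ^-pos p (suc n) = pos*pos⇒pos p (p ^ n) {{^-pos p n}}

  -- Informally, exp(r j) ≤ (1 - r)⁻ʲ ≤ a. If `q ≤ ι j * r` held, `exp-bound` would contradict
  -- `a < x`.
  log-≺ : ∀ {a X} r j → 0ℚ ≤ r → r ≤ 1ℚ → .{{_ : Positive (1ℚ - r)}} →
    a ≺ X → 1ℚ ≤ a * (1ℚ - r) ^ j → ι j * r ≺ log X
  log-≺ {a} r j 0≤r r≤1 a≺X 1≤ q (x , Xx , x<expq) = ≰⇒> λ q≤jr → <-irrefl refl (begin-strict
    1ℚ                  ≤⟨ 1≤ ⟩
    a * (1ℚ - r) ^ j    <⟨ *-monoˡ-<-pos ((1ℚ - r) ^ j) {{^-pos (1ℚ - r) j}} (a≺X x Xx) ⟩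
    x * (1ℚ - r) ^ j    ≤⟨ exp-bound r j 0≤r r≤1 q≤jr x<expq ⟩
    1ℚ                  ∎)
    where open ≤-Reasoning

  log-2^ : ∀ {n} L → 2 ℕ.^ L ℕ.≤ n → ι L * ½ ≺ log (fromℕ n)
  log-2^ {n} L 2^L≤n = log-≺ ½ L (from-yes (0ℚ ≤? ½)) (from-yes (½ ≤? 1ℚ)) (λ q n<q → ≤-<-trans (ι-mono-≤ 2^L≤n) n<q)
    (≤-reflexive (sym (2^L*½^L≡1 L)))
    where
    open +-*-Solver
    2^L*½^L≡1 : ∀ L → ι (2 ℕ.^ L) * (1ℚ - ½) ^ L ≡ 1ℚ
    2^L*½^L≡1 zero    = refl
    2^L*½^L≡1 (suc L) = trans (cong (_* ((1ℚ - ½) * (1ℚ - ½) ^ L)) (ι-* 2 (2 ℕ.^ L)))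
      (trans (solve 2 (λ a b → (con (ι 2) :* a) :* (con ½ :* b) := a :* b) refl (ι (2 ℕ.^ L)) (½ ^ L)) (2^L*½^L≡1 L))

  -- Here 9 · 4/35 = 36/35 and 3 · (31/35)⁹ ≥ 1. A bound above 1 is required for a positive lower
  -- bound on the iterated logarithm.
  log-3 : ∀ {n} → 3 ℕ.≤ n → + 36 / 35 ≺ log (fromℕ n)
  log-3 {n} 3≤n = log-≺ (+ 4 / 35) 9 (from-yes (0ℚ ≤? + 4 / 35)) (from-yes (+ 4 / 35 ≤? 1ℚ))
    (λ q n<q → ≤-<-trans (ι-mono-≤ 3≤n) n<q)
    (from-yes (1ℚ ≤? ι 3 * (1ℚ - + 4 / 35) ^ 9))

  log-log-3 : ∀ {n} → 3 ℕ.≤ n → + 1 / 36 ≺ log (log (fromℕ n))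
  log-log-3 3≤n = log-≺ (+ 1 / 36) 1 (from-yes (0ℚ ≤? + 1 / 36)) (from-yes (+ 1 / 36 ≤? 1ℚ)) (log-3 3≤n)
    (from-yes (1ℚ ≤? + 36 / 35 * (1ℚ - + 1 / 36) ^ 1))

  -- The constant is 31104 = 12 · 2 · 36²: the 2 comes from log n ≥ L/2, and each 36 from log log n
  -- ≥ 1/36.
  bound-from-log₂ : ∀ {N n L} → 3 ℕ.≤ n → 2 ℕ.^ L ℕ.≤ n → N ℕ.≤ 12 ℕ.* (n ℕ.* L) →
    fromℕ N ≤ᵘ fromℕ 31104 *ᵘ fromℕ n *ᵘ log (fromℕ n) *ᵘ (log (log (fromℕ n)) *ᵘ log (log (fromℕ n)))
  bound-from-log₂ {N} {n} {L} 3≤n 2^L≤n N≤ q Yq = ≤-<-trans ιN≤ (lower q Yq)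
    where
    open ≤-Reasoning
    open +-*-Solver
    0≤C*n = 0≤* (0≤ι 31104) (0≤ι n)
    0≤L/2 = 0≤* (0≤ι L) (from-yes (0ℚ ≤? ½))
    0≤1/36 = from-yes (0ℚ ≤? + 1 / 36)
    lower : ι 31104 * ι n * (ι L * ½) * (+ 1 / 36 * (+ 1 / 36)) ≺ _
    lower = *ᵘ-≺ (0≤* 0≤C*n 0≤L/2) (0≤* 0≤1/36 0≤1/36)
      (*ᵘ-≺ 0≤C*n 0≤L/2 (*ᵘ-≺ (0≤ι 31104) (0≤ι n) (λ _ C<q → C<q) (λ _ n<q → n<q)) (log-2^ L 2^L≤n))
      (*ᵘ-≺ 0≤1/36 0≤1/36 (log-log-3 3≤n) (log-log-3 3≤n))
    ιN≤ : ι N ≤ ι 31104 * ι n * (ι L * ½) * (+ 1 / 36 * (+ 1 / 36))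
    ιN≤ = begin
      ι N                          ≤⟨ ι-mono-≤ N≤ ⟩
      ι (12 ℕ.* (n ℕ.* L))         ≡⟨ trans (ι-* 12 (n ℕ.* L)) (cong (ι 12 *_) (ι-* n L)) ⟩
      ι 12 * (ι n * ι L)           ≡⟨ solve 2 (λ n L → con (ι 12) :* (n :* L) := con (ι 31104) :* n :* (L :* con ½) :* (con (+ 1 / 36) :* con (+ 1 / 36))) refl (ι n) (ι L) ⟩
      ι 31104 * ι n * (ι L * ½) * (+ 1 / 36 * (+ 1 / 36))  ∎

module RootQuadruples where

  open QuadraticCongruence
  open import Data.Fin.Properties using (all?)
  open import Data.Integer.Base as ℤ using (ℤ; +_; -_; -[1+_]; ∣_∣; 0ℤ)
  import Data.Integer.Properties as ℤ
  import Data.Integer.Tactic.RingSolver as ℤSolver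
  open import Data.List.Base using (List; length; map; upTo; filter; deduplicate; cartesianProduct)
  open import Data.List.Membership.Propositional using (_∈_)
  open import Data.List.Membership.Propositional.Properties using (∈-map⁺; ∈-upTo⁺; ∈-filter⁺; ∈-filter⁻; ∈-deduplicate⁺; ∈-cartesianProduct⁺)
  import Data.List.Relation.Unary.Unique.DecPropositional.Properties as DecUnique
  open import Data.List.Relation.Unary.Unique.Propositional using (Unique)
  import Data.List.Relation.Unary.Unique.Propositional.Properties as Unique
  open import Data.Nat.Base
  open import Data.Nat.Divisibility
  open import Data.Nat.Primality using (euclidsLemma; prime[2])
  open import Data.Nat.Properties
  open import Data.Nat.Tactic.RingSolver using (solve-∀)
  open import Data.Product.Base using (∃-syntax; _×_; _,_; proj₂)
  open import Data.Sum.Base using (reduce)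
  open import Data.Vec.Base using ([]; _∷_)
  open import Data.Vec.Properties using (≡-dec)
  open import Function.Base using (_∘_)
  open import Function.Bundles using (mk⇔)
  open import Relation.Binary.PropositionalEquality
  open import Relation.Nullary using (Dec; yes; no; ¬?)
  open import Relation.Nullary.Decidable using (_×-dec_; map′)
  open import Relation.Unary using (Decidable)

  -- Root quadruples as reduced binary quadratic forms.

  reduced? : ∀ v → Dec (Reduced v)
  reduced? v = all? λ i → ¬? (∥ S i v ∥ <? ∥ v ∥)

  isRoot? : ∀ a b c d → Dec (IsRoot a b c d)
  isRoot? a b c d = map′
    (λ (r , a≤b , b≤c , c≤d , s≥0 , d≤ , d>0) → record
      { reduced = r ; a≤b = a≤b ; b≤c = b≤c ; c≤d = c≤d ; sum≥0 = s≥0 ; d≤a+b+c = d≤ ; d>0 = d>0 })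
    (λ r → let open IsRoot r in reduced , a≤b , b≤c , c≤d , sum≥0 , d≤a+b+c , d>0)
    (reduced? _ ×-dec a ℤ.≤? b ×-dec b ℤ.≤? c ×-dec c ℤ.≤? d ×-dec
     _ ℤ.≤? _ ×-dec _ ℤ.≤? _ ×-dec _ ℤ.<? _)

  rootWith? : ∀ k a₀ → Decidable (RootWith k a₀)
  rootWith? k a₀ v@(a ∷ b ∷ c ∷ d ∷ []) =
    isRoot? a b c d ×-dec _ ℤ.<? _ ×-dec Q𝒟 v ℤ.≟ k ×-dec a ℤ.≟ a₀

  quadruple : (n X k Y : ℕ) → Quadruple
  quadruple n X k Y =
    - + n ∷ + n ℤ.+ + X ∷ + n ℤ.+ + Y ∷ + n ℤ.+ + X ℤ.+ + Y ℤ.- + 2 ℤ.* + k ∷ []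

  -- The binary quadratic form X x² + 2 k x y + Y y² of determinant D, reduced with
  -- non-negative middle coefficient.
  record ReducedForm (D X k Y : ℕ) : Set where
    field
      2k≤X : 2 * k ≤ X
      X≤Y  : X ≤ Y
      det  : X * Y ≡ k * k + D

  -- The absolute value only serves to land in ℕ: for |m| < n² the difference is positive.
  determinant : ℤ → ℕ → ℕ
  determinant m n = ∣ + (n * n) ℤ.- m ∣

  module _ (m : ℤ) (n : ℕ) (∣m∣<n² : ∣ m ∣ < n * n) where

    private D = determinant m n

    +determinant : + D ≡ + (n * n) ℤ.- m
    +determinant = ℤ.0≤i⇒+∣i∣≡i (ℤ.i≤j⇒0≤j-i (m≤n² m ∣m∣<n²))
      where
      m≤n² : ∀ m → ∣ m ∣ < n * n → m ℤ.≤ + (n * n)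
      m≤n² (+ a)    a<n² = ℤ.+≤+ (<⇒≤ a<n²)
      m≤n² -[1+ a ] _    = ℤ.-≤+

    determinant≢0 : NonZero D
    determinant≢0 = ≢-nonZero λ D≡0 → <-irrefl
      (cong ∣_∣ (sym (ℤ.i-j≡0⇒i≡j (+ (n * n)) m (ℤ.∣i∣≡0⇒i≡0 D≡0)))) ∣m∣<n²

    determinant< : D < 2 * (n * n)
    determinant< = begin-strict
      D                  ≤⟨ ℤ.∣i-j∣≤∣i∣+∣j∣ (+ (n * n)) m ⟩
      n * n + ∣ m ∣      <⟨ +-monoʳ-< (n * n) ∣m∣<n² ⟩
      n * n + n * n      ≡⟨ cong (λ z → n * n + z) (+-identityʳ (n * n)) ⟨
      2 * (n * n)        ∎
      where open ≤-Reasoning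

    -- With p = a + b + c - d, the identity 4XY = p² + 4n² - Q yields 4XY = p² + 4D, so p is even.
    -- The bounds 0 ≤ p and p ≤ X restate d ≤ a + b + c and c ≤ d.
    root⇒form : ∀ {v} → RootWith (+ 4 ℤ.* m) (- + n) v →
      ∃[ X ] ∃[ k ] ∃[ Y ] ReducedForm D X k Y × v ≡ quadruple n X k Y
    root⇒form {a ∷ b ∷ c ∷ d ∷ []} (isRoot , _ , Q≡ , refl) = X , k , Y , form , v≡
      where
      open IsRoot isRoot
      0≤X : 0ℤ ℤ.≤ b ℤ.- + n
      0≤X = subst (0ℤ ℤ.≤_) (e b c (+ n)) (ℤ.i≤j⇒0≤j-i (ℤ.≤-trans c≤d d≤a+b+c))
        where
        e : ∀ b c n → - n ℤ.+ b ℤ.+ c ℤ.- c ≡ b ℤ.- n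
        e = ℤSolver.solve-∀
      X≤Yℤ : b ℤ.- + n ℤ.≤ c ℤ.- + n
      X≤Yℤ = ℤ.+-monoˡ-≤ (- + n) b≤c
      0≤p : 0ℤ ℤ.≤ - + n ℤ.+ b ℤ.+ c ℤ.- d
      0≤p = ℤ.i≤j⇒0≤j-i d≤a+b+c
      X Y p : ℕ
      X = ∣ b ℤ.- + n ∣
      Y = ∣ c ℤ.- + n ∣
      p = ∣ - + n ℤ.+ b ℤ.+ c ℤ.- d ∣
      +X = ℤ.0≤i⇒+∣i∣≡i 0≤X
      +Y = ℤ.0≤i⇒+∣i∣≡i (ℤ.≤-trans 0≤X X≤Yℤ)
      +p = ℤ.0≤i⇒+∣i∣≡i 0≤p
      p≤X : p ≤ X
      p≤X = ℤ.drop‿+≤+ (subst₂ ℤ._≤_ (sym +p) (sym +X)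
        (ℤ.0≤i-j⇒j≤i (subst (0ℤ ℤ.≤_) (e b c d (+ n)) (ℤ.i≤j⇒0≤j-i c≤d))))
        where
        e : ∀ b c d n → d ℤ.- c ≡ b ℤ.- n ℤ.- (- n ℤ.+ b ℤ.+ c ℤ.- d)
        e = ℤSolver.solve-∀
      4XY≡ : 4 * (X * Y) ≡ p * p + 4 * D
      4XY≡ = ℤ.+-injective (begin
        + (4 * (X * Y))                                   ≡⟨ ℤ.pos-* 4 (X * Y) ⟩
        + 4 ℤ.* + (X * Y)                                 ≡⟨ cong (+ 4 ℤ.*_) (trans (ℤ.pos-* X Y) (cong₂ ℤ._*_ +X +Y)) ⟩
        + 4 ℤ.* ((b ℤ.- + n) ℤ.* (c ℤ.- + n))             ≡⟨ e b c d (+ n) ⟩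
        p′ ℤ.* p′ ℤ.+ (+ 4 ℤ.* (+ n ℤ.* + n) ℤ.- Q𝒟 (- + n ∷ b ∷ c ∷ d ∷ []))
          ≡⟨ cong (λ q → p′ ℤ.* p′ ℤ.+ (+ 4 ℤ.* (+ n ℤ.* + n) ℤ.- q)) Q≡ ⟩
        p′ ℤ.* p′ ℤ.+ (+ 4 ℤ.* (+ n ℤ.* + n) ℤ.- + 4 ℤ.* m)
          ≡⟨ cong (λ z → p′ ℤ.* p′ ℤ.+ z) (e′ (+ n ℤ.* + n) m) ⟩
        p′ ℤ.* p′ ℤ.+ + 4 ℤ.* (+ n ℤ.* + n ℤ.- m)
          ≡⟨ cong₂ (λ p D → p ℤ.* p ℤ.+ + 4 ℤ.* D) (sym +p) (sym (trans +determinant (cong (ℤ._- m) (ℤ.pos-* n n)))) ⟩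
        + p ℤ.* + p ℤ.+ + 4 ℤ.* + D                       ≡⟨ cong₂ ℤ._+_ (ℤ.pos-* p p) (ℤ.pos-* 4 D) ⟨
        + (p * p) ℤ.+ + (4 * D)                           ≡⟨ ℤ.pos-+ (p * p) (4 * D) ⟨
        + (p * p + 4 * D)                                 ∎)
        where
        open ≡-Reasoning
        p′ = - + n ℤ.+ b ℤ.+ c ℤ.- d
        e : ∀ b c d n → + 4 ℤ.* ((b ℤ.- n) ℤ.* (c ℤ.- n)) ≡
          (- n ℤ.+ b ℤ.+ c ℤ.- d) ℤ.* (- n ℤ.+ b ℤ.+ c ℤ.- d) ℤ.+ (+ 4 ℤ.* (n ℤ.* n) ℤ.-
          (+ 2 ℤ.* (- n ℤ.* - n ℤ.+ (b ℤ.* b ℤ.+ (c ℤ.* c ℤ.+ (d ℤ.* d ℤ.+ + 0)))) ℤ.-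
            (- n ℤ.+ (b ℤ.+ (c ℤ.+ (d ℤ.+ + 0)))) ℤ.* (- n ℤ.+ (b ℤ.+ (c ℤ.+ (d ℤ.+ + 0))))))
        e = ℤSolver.solve-∀
        e′ : ∀ N m → + 4 ℤ.* N ℤ.- + 4 ℤ.* m ≡ + 4 ℤ.* (N ℤ.- m)
        e′ = ℤSolver.solve-∀
      2∣p : 2 ∣ p
      2∣p = reduce (euclidsLemma p p prime[2] (∣-minus {n = 4 * D}
        (subst (2 ∣_) 4XY≡ (∣m⇒∣m*n (X * Y) (divides 2 refl))) (∣m⇒∣m*n D (divides 2 refl))))
      k = quotient 2∣p
      p≡2k : p ≡ 2 * k
      p≡2k = m∣n⇒n≡m*quotient 2∣p
      form : ReducedForm D X k Y
      form = record
        { 2k≤X = subst (_≤ X) p≡2k p≤X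
        ; X≤Y  = ℤ.drop‿+≤+ (subst₂ ℤ._≤_ (sym +X) (sym +Y) X≤Yℤ)
        ; det  = *-cancelˡ-≡ (X * Y) (k * k + D) 4
            (trans 4XY≡ (trans (cong (λ p → p * p + 4 * D) p≡2k) (e k D)))
        }
        where
        e : ∀ k D → 2 * k * (2 * k) + 4 * D ≡ 4 * (k * k + D)
        e = solve-∀
      v≡ : - + n ∷ b ∷ c ∷ d ∷ [] ≡ quadruple n X k Y
      v≡ = cong (λ z → - + n ∷ z) (cong₂ _∷_ (b≡ b +X) (cong₂ _∷_ (b≡ c +Y) (cong (_∷ []) d≡)))
        where
        e : ∀ b n → b ≡ n ℤ.+ (b ℤ.- n)
        e = ℤSolver.solve-∀
        b≡ : ∀ b {X} → + X ≡ b ℤ.- + n → b ≡ + n ℤ.+ + X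
        b≡ b +X = trans (e b (+ n)) (cong (λ z → + n ℤ.+ z) (sym +X))
        e′ : ∀ b c d n → d ≡ n ℤ.+ (b ℤ.- n) ℤ.+ (c ℤ.- n) ℤ.- (- n ℤ.+ b ℤ.+ c ℤ.- d)
        e′ = ℤSolver.solve-∀
        +2k : + 2 ℤ.* + k ≡ - + n ℤ.+ b ℤ.+ c ℤ.- d
        +2k = trans (sym (ℤ.pos-* 2 k)) (trans (cong +_ (sym p≡2k)) +p)
        d≡ : d ≡ + n ℤ.+ + X ℤ.+ + Y ℤ.- + 2 ℤ.* + k
        d≡ = trans (e′ b c d (+ n))
          (cong₂ ℤ._-_ (cong₂ (λ X Y → + n ℤ.+ X ℤ.+ Y) (sym +X) (sym +Y)) (sym +2k))

  -- Size bounds for reduced forms.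

  module _ {D X k Y : ℕ} .{{_ : NonZero D}} (form : ReducedForm D X k Y) where

    open ReducedForm form

    form-X≢0 : NonZero X
    form-X≢0 = ≢-nonZero λ { refl → ≢-nonZero⁻¹ D (m+n≡0⇒n≡0 (k * k) (sym det)) }

    form-k<X : k < X
    form-k<X = ≰⇒> λ X≤k → ≢-nonZero⁻¹ X {{form-X≢0}} (n≤0⇒n≡0 (≤-trans X≤k (k≤0 (≤-trans 2k≤X X≤k))))
      where
      k≤0 : 2 * k ≤ k → k ≤ 0
      k≤0 2k≤k = +-cancelˡ-≤ k k 0 (subst₂ _≤_ (cong (λ z → k + z) (+-identityʳ k)) (sym (+-identityʳ k)) 2k≤k)

    -- A crude bound, which makes the search space for `candidates` finite.
    form-Y≤ : Y ≤ X * X + D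
    form-Y≤ = begin
      Y           ≤⟨ m≤n*m Y X {{form-X≢0}} ⟩
      X * Y       ≡⟨ det ⟩
      k * k + D   ≤⟨ +-monoˡ-≤ D (*-mono-≤ (<⇒≤ form-k<X) (<⇒≤ form-k<X)) ⟩
      X * X + D   ∎
      where open ≤-Reasoning

    -- The classical reduction bound: 4X² ≤ 4XY = (2k)² + 4D ≤ X² + 4D.
    form-3X²≤4D : 3 * (X * X) ≤ 4 * D
    form-3X²≤4D = +-cancelˡ-≤ (X * X) (3 * (X * X)) (4 * D) (begin
      4 * (X * X)              ≤⟨ *-monoʳ-≤ 4 (*-monoʳ-≤ X X≤Y) ⟩
      4 * (X * Y)              ≡⟨ cong (4 *_) det ⟩
      4 * (k * k + D)          ≡⟨ e k D ⟩
      2 * k * (2 * k) + 4 * D  ≤⟨ +-monoˡ-≤ (4 * D) (*-mono-≤ 2k≤X 2k≤X) ⟩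
      X * X + 4 * D            ∎)
      where
      open ≤-Reasoning
      e : ∀ k D → 4 * (k * k + D) ≡ 2 * k * (2 * k) + 4 * D
      e = solve-∀

    form-X<2n : ∀ {n} → D < 2 * (n * n) → X < 2 * n
    form-X<2n {n} D<2n² = ≰⇒> λ 2n≤X → <-irrefl refl (begin-strict
      12 * (n * n)              ≡⟨ e n ⟩
      3 * (2 * n * (2 * n))     ≤⟨ *-monoʳ-≤ 3 (*-mono-≤ 2n≤X 2n≤X) ⟩
      3 * (X * X)               ≤⟨ form-3X²≤4D ⟩
      4 * D                     <⟨ *-monoʳ-< 4 D<2n² ⟩
      4 * (2 * (n * n))         ≡⟨ *-assoc 4 2 (n * n) ⟨
      8 * (n * n)               ≤⟨ *-monoˡ-≤ (n * n) (m≤n+m 8 4) ⟩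
      12 * (n * n)              ∎)
      where
      open ≤-Reasoning
      e : ∀ n → 12 * (n * n) ≡ 3 * (2 * n * (2 * n))
      e = solve-∀

  log₂-bounds : ∀ n → 2 ≤ n → ∃[ L ] 1 ≤ L × 2 ^ L ≤ n × n < 2 ^ suc L
  log₂-bounds (suc n) 2≤1+n with n ≟ 1
  ... | yes refl = 1 , ≤-refl , ≤-refl , s≤s (s≤s (s≤s z≤n))
  ... | no n≢1 with L , 1≤L , 2^L≤n , n<2^1+L ← log₂-bounds n (≤∧≢⇒< (≤-pred 2≤1+n) (n≢1 ∘ sym))
               with suc n <? 2 ^ suc L
  ... | yes 1+n< = L , 1≤L , m≤n⇒m≤1+n 2^L≤n , 1+n<
  ... | no  1+n≮ = suc L , s≤s z≤n , ≮⇒≥ 1+n≮ , ≤-<-trans n<2^1+L (^-monoʳ-< 2 ≤-refl (n<1+n (suc L)))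

  -- Enumerating and counting the root quadruples.

  module _ (m : ℤ) (n : ℕ) (∣m∣<n² : ∣ m ∣ < n * n) where

    private
      D = determinant m n
      instance _ = determinant≢0 m n ∣m∣<n²
      D< = determinant< m n ∣m∣<n²
      P = RootWith (+ 4 ℤ.* m) (- + n)
      _≟ᵥ_ = ≡-dec {n = 4} ℤ._≟_
      B = suc (2 * n * (2 * n) + D)

    -- A finite box containing every root quadruple; removing duplicates and filtering it produces
    -- the list that witnesses the cardinality.
    candidates : List Quadruple
    candidates = map (λ (X , k , Y) → quadruple n X k Y)
      (cartesianProduct (upTo (2 * n)) (cartesianProduct (upTo (2 * n)) (upTo B)))

    ∈-candidates : ∀ {v} → P v → v ∈ candidates
    ∈-candidates Pv with X , k , Y , form , refl ← root⇒form m n ∣m∣<n² Pv =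
      ∈-map⁺ _ (∈-cartesianProduct⁺ (∈-upTo⁺ X<) (∈-cartesianProduct⁺
        (∈-upTo⁺ (<-trans (form-k<X form) X<))
        (∈-upTo⁺ (s≤s (≤-trans (form-Y≤ form) (+-monoˡ-≤ D (*-mono-≤ (<⇒≤ X<) (<⇒≤ X<))))))))
      where
      X< = form-X<2n form {n} D<

    roots : List Quadruple
    roots = filter (rootWith? (+ 4 ℤ.* m) (- + n)) (deduplicate _≟ᵥ_ candidates)

    roots-unique : Unique roots
    roots-unique = Unique.filter⁺ (rootWith? _ _) (DecUnique.deduplicate-! _≟ᵥ_ candidates)

    isN-root : IsN-root (+ 4 ℤ.* m) (- + n) (length roots)
    isN-root = roots , roots-unique , (λ v → mk⇔ (proj₂ ∘ ∈-filter⁻ (rootWith? _ _) {xs = deduplicate _≟ᵥ_ candidates})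
      (λ Pv → ∈-filter⁺ (rootWith? _ _) (∈-deduplicate⁺ _≟ᵥ_ (∈-candidates Pv)) Pv)) , refl

    roots-≤-pairs : length roots ≤ length (hyperbolaPairs (2 * (2 * n)) (2 * n))
    roots-≤-pairs with H , isH ← squareRootPart D = length-≤ R injective (hyperbolaPairs (2 * (2 * n)) (2 * n)) roots-unique total
      where
      R : Quadruple → ℕ × ℕ → Set
      R v (t , w) = ∃[ X ] ∃[ k ] ∃[ Y ] ReducedForm D X k Y × v ≡ quadruple n X k Y × Code D H X k t w
      injective : ∀ {v v′ tw} → R v tw → R v′ tw → v ≡ v′
      injective (X , k , Y , form , refl , code) (X′ , k′ , Y′ , form′ , refl , code′)
        -- The code determines `X` and `k`; as `X` is nonzero, the determinant equation then
        -- determines `Y`.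
        with refl , refl ← code-injective code code′ =
        cong (quadruple n X k) (*-cancelˡ-≡ Y Y′ X {{form-X≢0 form}} (trans (det form) (sym (det form′))))
        where open ReducedForm
      total : ∀ {v} → v ∈ roots → ∃[ tw ] tw ∈ hyperbolaPairs (2 * (2 * n)) (2 * n) × R v tw
      total v∈roots with _ , Pv ← ∈-filter⁻ (rootWith? _ _) {xs = deduplicate _≟ᵥ_ candidates} v∈roots
        with X , k , Y , form , v≡ ← root⇒form m n ∣m∣<n² Pv
        with t , w , code , 0<t , t≤X , wt≤ ← code-exists isH (divides Y (trans (sym (ReducedForm.det form)) (*-comm X Y))) (form-k<X form) =
        (t , w) , ∈-hyperbolaPairs 0<t (≤-trans t≤X X≤2n) (≤-trans wt≤ (*-monoʳ-≤ 2 X≤2n)) , X , k , Y , form , v≡ , code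
        where
        X≤2n = <⇒≤ (form-X<2n form {n} D<)

    roots-bound : 2 ≤ n → ∃[ L ] 2 ^ L ≤ n × length roots ≤ 12 * (n * L)
    roots-bound 2≤n with L , 1≤L , 2^L≤n , n<2^1+L ← log₂-bounds n 2≤n = L , 2^L≤n , (begin
      length roots                                     ≤⟨ roots-≤-pairs ⟩
      length (hyperbolaPairs (2 * (2 * n)) (2 * n))    ≤⟨ length-hyperbolaPairs (2 * (2 * n)) (2 * n) (2 + L) (*-monoʳ-< 2 n<2^1+L) ⟩
      (2 + L) * (2 * (2 * n))                          ≤⟨ *-monoˡ-≤ (2 * (2 * n)) (+-monoˡ-≤ L (*-monoʳ-≤ 2 1≤L)) ⟩
      (2 * L + L) * (2 * (2 * n))                      ≡⟨ e L n ⟩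
      12 * (n * L)                                     ∎)
      where
      open ≤-Reasoning
      e : ∀ L n → (2 * L + L) * (2 * (2 * n)) ≡ 12 * (n * L)
      e = solve-∀

open import Data.Integer.Base using (ℤ; +_; -_; ∣_∣; _*_)
open import Data.Nat.Base as ℕ using (ℕ; _<_; _≤_)
open import Data.Nat.Properties using (<⇒≤)
open import Data.Product.Base using (∃-syntax; _×_; _,_)
open LogarithmBounds using (bound-from-log₂)
open RootQuadruples using (isN-root; roots-bound)

theorem4p2 : ∃[ C ] ((m : ℤ) (n : ℕ) → ∣ m ∣ < n ℕ.* n → 3 ≤ n →
    ∃[ N ] IsN-root ((+ 4) * m) (- (+ n)) N ×
    fromℕ N ≤ᵘ fromℕ C *ᵘ fromℕ n *ᵘ log (fromℕ n) *ᵘ (log (log (fromℕ n)) *ᵘ log (log (fromℕ n))))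
theorem4p2 = 31104 , λ m n ∣m∣<n² 3≤n →
  let L , 2^L≤n , N≤12nL = roots-bound m n ∣m∣<n² (<⇒≤ 3≤n) in
  _ , isN-root m n ∣m∣<n² , bound-from-log₂ {L = L} 3≤n 2^L≤n N≤12nL
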